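{- Let $p>3$ be a prime number. Then $$\sum_{\substack{1\le m\le p-1\\ m\text{ odd}}}(-1)^{\frac{m+1}{2}}\,m\,T_m\equiv\begin{cases}0\pmod p&\text{if }p\equiv 1\pmod 4,\\ 2\pmod p&\text{if }p\equiv 3\pmod 4.\end{cases}$$
   Context: $T_m$ denotes the $m$-th tangent number, the integer defined by the series expansion $\tan z=\sum_{m\ge 0}T_m\frac{z^m}{m!}$ for $|z|<\frac{\pi}{2}$ (so $T_1=1$, $T_3=2$, $T_5=16$, $T_7=272$, and $T_m=0$ for $m$ even). -}

module Defs where

open import Data.Nat as ℕ using (ℕ; zero; suc; _∸_; _!)
open import Data.Nat.Combinatorics using (_C_; nCk≡n!/k![n-k]!; nCn≡1; k![n∸k]!∣n!)
import Data.Nat.Divisibility as ℕ∣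
open import Data.Nat.DivMod using (m/n*n≡m)
open import Data.Nat.Induction using (<-rec; <-wellFounded)
import Data.Nat.Properties as ℕ
open import Data.Integer as ℤ using (ℤ; +_; 0ℤ; 1ℤ)
open import Data.Integer.Divisibility using (_∣_)
import Data.Integer.Properties as ℤ
open import Data.Integer.Tactic.RingSolver using (solve-∀)
open import Data.Rational using (ℚ; _/_; _+_; _*_; toℚᵘ)
import Data.Rational.Properties as ℚ
import Data.Rational.Unnormalised as ℚᵘ
import Data.Rational.Unnormalised.Properties as ℚᵘ
open import Data.Fin using (Fin; toℕ; fromℕ; inject₁)
open import Data.Fin.Properties using (toℕ<n; toℕ-inject₁; toℕ-fromℕ)
open import Data.List using (List; applyUpTo; filter; foldr; map; upTo; []; _∷_)
open import Function using (_∘_)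
open import Induction.WellFounded using (module FixPoint)
open import Relation.Binary.PropositionalEquality
open import Relation.Nullary.Decidable using (¬?)
open import Algebra.Properties.CommutativeMonoid.Sum ℚ.+-0-commutativeMonoid
  using (sum; sum⁺-syntax; sum-cong-≗)
open import Algebra.Properties.CommutativeMonoid.Sum ℤ.+-0-commutativeMonoid
  using () renaming
  ( sum to sumℤ; sum-cong-≗ to sumℤ-cong-≗; sum-init-last to sumℤ-init-last )

-- A formal power series is its sequence of coefficients.

Series : Set
Series = ℕ → ℚ

infixl 7 _·_

_·_ : Series → Series → Series
(f · g) n = ∑[ k ≤ n ] (f (toℕ k) * g (n ∸ toℕ k))

-- egf a = Σ aₙ zⁿ / n!

egf : (ℕ → ℤ) → Series
egf a n = (a n / (n !)) {{n ℕ.!≢0}}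

-- Derivatives at 0 of sin and cos.

sin⁽_⁾ cos⁽_⁾ : ℕ → ℤ
sin⁽ 0 ⁾           = 0ℤ
sin⁽ 1 ⁾           = 1ℤ
sin⁽ suc (suc n) ⁾ = ℤ.- sin⁽ n ⁾
cos⁽ 0 ⁾           = 1ℤ
cos⁽ 1 ⁾           = 0ℤ
cos⁽ suc (suc n) ⁾ = ℤ.- cos⁽ n ⁾

sin cos : Series
sin = egf sin⁽_⁾
cos = egf cos⁽_⁾

-- f is the expansion of sin / cos; the quotient is unique since cos has
-- constant term 1.

IsTan : Series → Set
IsTan f = f · cos ≗ sin

IsTangentNumbers : (ℕ → ℤ) → Set
IsTangentNumbers T = IsTan (egf T)

infix 4 _≡_[mod_]

_≡_[mod_] : ℤ → ℤ → ℕ → Set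
a ≡ b [mod n ] = + n ∣ a ℤ.- b

oddsUpTo : ℕ → List ℕ
oddsUpTo n = filter (λ m → ¬? (2 ℕ∣.∣? m)) (applyUpTo suc n)

sumOver : List ℕ → (ℕ → ℤ) → ℤ
sumOver ms f = foldr ℤ._+_ 0ℤ (map f ms)

-- Existence: multiplying the n-th coefficient of tan · cos = sin by n! gives
-- Σₖ (n C k) Tₖ cos⁽ n ∸ k ⁾ = sin⁽ n ⁾, which determines Tₙ over ℤ.

private
  conv : (T : ℕ → ℤ) (n k : ℕ) → ℤ
  conv T n k = + (n C k) ℤ.* T k ℤ.* cos⁽ n ∸ k ⁾

  step : ∀ n → (∀ {k} → k ℕ.< n → ℤ) → ℤ
  step n T = sin⁽ n ⁾ ℤ.- sumℤ {n} λ k →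
    + (n C toℕ k) ℤ.* T (toℕ<n k) ℤ.* cos⁽ n ∸ toℕ k ⁾

tangentNumber : ℕ → ℤ
tangentNumber = <-rec (λ _ → ℤ) step

private
  T = tangentNumber

  step-ext : ∀ n {f g : ∀ {k} → k ℕ.< n → ℤ} →
             (∀ {k} (k<n : k ℕ.< n) → f k<n ≡ g k<n) → step n f ≡ step n g
  step-ext n f≗g = cong (λ s → sin⁽ n ⁾ ℤ.- s) (sumℤ-cong-≗ {n} λ k →
    cong (λ t → + (n C toℕ k) ℤ.* t ℤ.* cos⁽ n ∸ toℕ k ⁾) (f≗g (toℕ<n k)))

  unfold : ∀ n → T n ≡ sin⁽ n ⁾ ℤ.- sumℤ {n} (conv T n ∘ toℕ)
  unfold n = FixPoint.unfold-wfRec <-wellFounded (λ _ → ℤ) step step-ext {n}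

  convolution : ∀ n → sumℤ {suc n} (conv T n ∘ toℕ) ≡ sin⁽ n ⁾
  convolution n = begin
    sumℤ {suc n} (conv T n ∘ toℕ)
      ≡⟨ sumℤ-init-last {n} (conv T n ∘ toℕ) ⟩
    sumℤ {n} (conv T n ∘ toℕ ∘ inject₁) ℤ.+ conv T n (toℕ (fromℕ n))
      ≡⟨ cong₂ ℤ._+_ (sumℤ-cong-≗ {n} λ k → cong (conv T n) (toℕ-inject₁ k))
                     (cong (conv T n) (toℕ-fromℕ n)) ⟩
    S ℤ.+ conv T n n
      ≡⟨ cong (λ t → S ℤ.+ t) (cong₂ (λ c d → + c ℤ.* T n ℤ.* cos⁽ d ⁾) (nCn≡1 n) (ℕ.n∸n≡0 n)) ⟩
    S ℤ.+ 1ℤ ℤ.* T n ℤ.* 1ℤ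
      ≡⟨ cong (λ t → S ℤ.+ 1ℤ ℤ.* t ℤ.* 1ℤ) (unfold n) ⟩
    S ℤ.+ 1ℤ ℤ.* (sin⁽ n ⁾ ℤ.- S) ℤ.* 1ℤ
      ≡⟨ cancel S sin⁽ n ⁾ ⟩
    sin⁽ n ⁾ ∎
    where
    open ≡-Reasoning
    S = sumℤ {n} (conv T n ∘ toℕ)
    cancel : ∀ s x → s ℤ.+ 1ℤ ℤ.* (x ℤ.- s) ℤ.* 1ℤ ≡ x
    cancel = solve-∀

  toℚᵘ-/ : ∀ x d .{{_ : ℕ.NonZero d}} → toℚᵘ (x / d) ℚᵘ.≃ x ℚᵘ./ d
  toℚᵘ-/ x (suc d) = ℚ.toℚᵘ-fromℚᵘ (ℚᵘ.mkℚᵘ x d)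

  /-+ : ∀ x y d .{{_ : ℕ.NonZero d}} → x / d + y / d ≡ (x ℤ.+ y) / d
  /-+ x y d@(suc _) = ℚ.toℚᵘ-injective (begin
    toℚᵘ (x / d + y / d)               ≈⟨ ℚ.toℚᵘ-homo-+ (x / d) (y / d) ⟩
    toℚᵘ (x / d) ℚᵘ.+ toℚᵘ (y / d)     ≈⟨ ℚᵘ.+-cong (toℚᵘ-/ x d) (toℚᵘ-/ y d) ⟩
    x ℚᵘ./ d ℚᵘ.+ y ℚᵘ./ d             ≈⟨ ℚᵘ.*≡* (common x y (+ d)) ⟩
    (x ℤ.+ y) ℚᵘ./ d                   ≈⟨ toℚᵘ-/ (x ℤ.+ y) d ⟨
    toℚᵘ ((x ℤ.+ y) / d)               ∎)
    where
    open ℚᵘ.≃-Reasoning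
    common : ∀ x y d → (x ℤ.* d ℤ.+ y ℤ.* d) ℤ.* d ≡ (x ℤ.+ y) ℤ.* (d ℤ.* d)
    common = solve-∀

  /-* : ∀ x y z a b d .{{_ : ℕ.NonZero a}} .{{_ : ℕ.NonZero b}} .{{_ : ℕ.NonZero d}} →
        (x ℤ.* y) ℤ.* + d ≡ z ℤ.* (+ a ℤ.* + b) → (x / a) * (y / b) ≡ z / d
  /-* x y z a@(suc _) b@(suc _) d@(suc _) eq = ℚ.toℚᵘ-injective (begin
    toℚᵘ (x / a * (y / b))             ≈⟨ ℚ.toℚᵘ-homo-* (x / a) (y / b) ⟩
    toℚᵘ (x / a) ℚᵘ.* toℚᵘ (y / b)     ≈⟨ ℚᵘ.*-cong (toℚᵘ-/ x a) (toℚᵘ-/ y b) ⟩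
    x ℚᵘ./ a ℚᵘ.* (y ℚᵘ./ b)           ≈⟨ ℚᵘ.*≡* eq ⟩
    z ℚᵘ./ d                           ≈⟨ toℚᵘ-/ z d ⟨
    toℚᵘ (z / d)                       ∎)
    where open ℚᵘ.≃-Reasoning

  0/ : ∀ d .{{_ : ℕ.NonZero d}} → 0ℤ / d ≡ 0ℤ / 1
  0/ d@(suc _) = ℚ.toℚᵘ-injective (ℚᵘ.≃-trans (toℚᵘ-/ 0ℤ d) (ℚᵘ.*≡* refl))

  sum-/ : ∀ n (f : Fin n → ℤ) d .{{_ : ℕ.NonZero d}} →
          sum (λ k → f k / d) ≡ sumℤ f / d
  sum-/ zero    f d = sym (0/ d)
  sum-/ (suc n) f d = trans (cong (λ s → f Fin.zero / d + s) (sum-/ n (f ∘ Fin.suc) d))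
                            (/-+ (f Fin.zero) _ d)

  C-! : ∀ {n k} → k ℕ.≤ n → (n C k) ℕ.* (k ! ℕ.* (n ∸ k) !) ≡ n !
  C-! {n} {k} k≤n = trans (cong (ℕ._* (k ! ℕ.* (n ∸ k) !)) (nCk≡n!/k![n-k]! k≤n))
                          (m/n*n≡m {{k ℕ.!* (n ∸ k) !≢0}} (k![n∸k]!∣n! k≤n))

  term : ∀ n k → k ℕ.≤ n → egf T k * cos (n ∸ k) ≡ (conv T n k / (n !)) {{n ℕ.!≢0}}
  term n k k≤n = /-* (T k) c (conv T n k) (k !) ((n ∸ k) !) (n !)
    {{k ℕ.!≢0}} {{(n ∸ k) ℕ.!≢0}} {{n ℕ.!≢0}} (begin
    T k ℤ.* c ℤ.* + (n !)
      ≡⟨ cong (λ m → T k ℤ.* c ℤ.* + m) (C-! k≤n) ⟨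
    T k ℤ.* c ℤ.* + ((n C k) ℕ.* (k ! ℕ.* (n ∸ k) !))
      ≡⟨ cong (T k ℤ.* c ℤ.*_) (trans (ℤ.pos-* (n C k) _)
           (cong (+ (n C k) ℤ.*_) (ℤ.pos-* (k !) _))) ⟩
    T k ℤ.* c ℤ.* (+ (n C k) ℤ.* (+ (k !) ℤ.* + ((n ∸ k) !)))
      ≡⟨ shuffle (T k) c (+ (n C k)) (+ (k !) ℤ.* + ((n ∸ k) !)) ⟩
    conv T n k ℤ.* (+ (k !) ℤ.* + ((n ∸ k) !)) ∎)
    where
    open ≡-Reasoning
    c = cos⁽ n ∸ k ⁾
    shuffle : ∀ t c b f → t ℤ.* c ℤ.* (b ℤ.* f) ≡ b ℤ.* t ℤ.* c ℤ.* f
    shuffle = solve-∀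

tangentNumber-isTangentNumbers : IsTangentNumbers tangentNumber
tangentNumber-isTangentNumbers n = begin
  sum {suc n} (λ k → egf T (toℕ k) * cos (n ∸ toℕ k))
    ≡⟨ sum-cong-≗ {n = suc n} (λ k → term n (toℕ k) (ℕ.≤-pred (toℕ<n k))) ⟩
  sum {suc n} (λ k → (conv T n (toℕ k) / (n !)) {{n ℕ.!≢0}})
    ≡⟨ sum-/ (suc n) (conv T n ∘ toℕ) (n !) {{n ℕ.!≢0}} ⟩
  (sumℤ {suc n} (conv T n ∘ toℕ) / (n !)) {{n ℕ.!≢0}}
    ≡⟨ cong (λ s → (s / (n !)) {{n ℕ.!≢0}}) (convolution n) ⟩
  sin n ∎
  where open ≡-Reasoning

_ : map tangentNumber (upTo 8) ≡
    + 0 ∷ + 1 ∷ + 0 ∷ + 2 ∷ + 0 ∷ + 16 ∷ + 0 ∷ + 272 ∷ []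
_ = refl

{-# OPTIONS --safe #-}
module Submission where

-- Let p = 2h + 1 and c = (−1)^h.  The identity
-- 2 sin (x z) cos z = sin ((x + 1) z) + sin ((x − 1) z), summed with alternating
-- signs over x = 1, 3, …, 2h − 1, telescopes to sin 0 and sin (2h z), and
-- 2h ≡ −1.  Comparing with tan · cos = sin, where cos has constant term 1, gives
--   Tₘ ≡ 2 c sin⁽ m ⁾ Σ_{i<h} (−1)^i (2i+1)^m  (mod p).
-- With P(x) = Σ_{1≤m<p} m x^m the sum in question is therefore congruent to
--   c Σ_{i<h} (−1)^i (P(−(2i+1)) − P(2i+1)).
-- By Fermat y² P(1 + y) ≡ −(1 + y) y, so P(1 + y) + 1 is odd in y as long as
-- y ≢ 0; hence this sum telescopes too, and its value is 1 − c.

open import Defs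
open import Data.Fin as Fin using (Fin; toℕ; fromℕ; inject₁)
open import Data.Fin.Properties using (toℕ<n; toℕ-inject₁; toℕ-fromℕ)
open import Data.Integer as ℤ using (ℤ; +_; -1ℤ; 0ℤ; 1ℤ; _*_; _^_)
import Data.Integer.Divisibility.Signed as ℤ∣
import Data.Integer.Properties as ℤ
open import Data.Integer.Tactic.RingSolver using (solve-∀)
open import Data.List using ([]; _∷_; filter; applyUpTo)
open import Data.Nat as ℕ using (ℕ; zero; suc; _∸_; _/_; _%_; _>_; _<_; _≤_; _!; z<s; s<s; s≤s)
open import Data.Nat.Combinatorics using (_C_; nCk≡n!/k![n-k]!; nCn≡1; k![n∸k]!∣n!)
import Data.Nat.Divisibility as ℕ∣
open import Data.Nat.DivMod using (m/n*n≡m; m≡m%n+[m/n]*n; +-distrib-/-∣ˡ)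
open import Data.Nat.Induction using (<-rec)
open import Data.Nat.Primality using (Prime; euclidsLemma; ¬prime[1]; prime⇒nonZero)
import Data.Nat.Properties as ℕ
import Data.Nat.Tactic.RingSolver as ℕ-Solver
open import Data.Product using (_×_; _,_)
open import Data.Rational as ℚ using (ℚ; toℚᵘ)
import Data.Rational.Properties as ℚ
import Data.Rational.Unnormalised as ℚᵘ
import Data.Rational.Unnormalised.Properties as ℚᵘ
open import Data.Sum using (inj₁; inj₂)
open import Function using (_∘_)
open import Relation.Binary using (Setoid)
open import Relation.Binary.PropositionalEquality
  using (_≡_; refl; sym; trans; cong; cong₂; subst; module ≡-Reasoning)
open import Relation.Nullary using (¬_; yes; no; contradiction)
open import Relation.Nullary.Decidable using (¬?; decidable-stable)
open import Relation.Unary using (Decidable)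
open import Algebra using (CommutativeMonoid; Ring)
open import Algebra.Properties.CommutativeSemigroup
  (CommutativeMonoid.commutativeSemigroup ℚ.*-1-commutativeMonoid)
  using (interchange)
import Algebra.Definitions.RawSemiring ℤ.+-*-rawSemiring as Raw
import Algebra.Properties.CommutativeSemiring.Binomial ℤ.+-*-commutativeSemiring as Binomial
import Algebra.Properties.Semiring.Sum (Ring.semiring ℚ.+-*-ring) as ℚ∑
open import Algebra.Properties.Semiring.Sum ℤ.+-*-semiring
  using (sum; sum-syntax; sum⁺-syntax; sum-cong-≗; sum-init-last; sum-replicate-zero; ∑-distrib-+; ∑-comm; *-distribˡ-sum)

module _ where
  open import Data.Integer using (_+_; _-_; -_)

  -- The embedding of ℤ in ℚ and the clearing of denominators.

  ι : ℤ → ℚ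
  ι x = x ℚ./ 1

  toℚᵘ-/ : ∀ x d .{{_ : ℕ.NonZero d}} → toℚᵘ (x ℚ./ d) ℚᵘ.≃ x ℚᵘ./ d
  toℚᵘ-/ x (suc d) = ℚ.toℚᵘ-fromℚᵘ (ℚᵘ.mkℚᵘ x d)

  ι-injective : ∀ {x y} → ι x ≡ ι y → x ≡ y
  ι-injective {x} {y} eq
    with ℚᵘ.*≡* e ← ℚᵘ.≃-trans (ℚᵘ.≃-sym (toℚᵘ-/ x 1)) (ℚᵘ.≃-trans (ℚᵘ.≃-reflexive (cong toℚᵘ eq)) (toℚᵘ-/ y 1))
    = trans (sym (ℤ.*-identityʳ x)) (trans e (ℤ.*-identityʳ y))

  ι-+ : ∀ x y → ι x ℚ.+ ι y ≡ ι (x + y)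
  ι-+ x y = ℚ.toℚᵘ-injective (begin
    toℚᵘ (ι x ℚ.+ ι y)            ≈⟨ ℚ.toℚᵘ-homo-+ (ι x) (ι y) ⟩
    toℚᵘ (ι x) ℚᵘ.+ toℚᵘ (ι y)    ≈⟨ ℚᵘ.+-cong (toℚᵘ-/ x 1) (toℚᵘ-/ y 1) ⟩
    x ℚᵘ./ 1 ℚᵘ.+ y ℚᵘ./ 1        ≈⟨ ℚᵘ.*≡* (units x y) ⟩
    (x + y) ℚᵘ./ 1                ≈⟨ toℚᵘ-/ (x + y) 1 ⟨
    toℚᵘ (ι (x + y))              ∎)
    where
    open ℚᵘ.≃-Reasoning
    units : ∀ x y → (x * 1ℤ + y * 1ℤ) * 1ℤ ≡ (x + y) * 1ℤ
    units = solve-∀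

  ι-*-/ : ∀ x y d .{{_ : ℕ.NonZero d}} → ι x ℚ.* (y ℚ./ d) ≡ (x * y) ℚ./ d
  ι-*-/ x y d@(suc _) = ℚ.toℚᵘ-injective (begin
    toℚᵘ (ι x ℚ.* (y ℚ./ d))            ≈⟨ ℚ.toℚᵘ-homo-* (ι x) (y ℚ./ d) ⟩
    toℚᵘ (ι x) ℚᵘ.* toℚᵘ (y ℚ./ d)      ≈⟨ ℚᵘ.*-cong (toℚᵘ-/ x 1) (toℚᵘ-/ y d) ⟩
    x ℚᵘ./ 1 ℚᵘ.* (y ℚᵘ./ d)            ≈⟨ ℚᵘ.*≡* (units x y (+ d)) ⟩
    (x * y) ℚᵘ./ d                      ≈⟨ toℚᵘ-/ (x * y) d ⟨
    toℚᵘ ((x * y) ℚ./ d)                ∎)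
    where
    open ℚᵘ.≃-Reasoning
    units : ∀ x y d → x * y * d ≡ x * y * (1ℤ * d)
    units = solve-∀

  ι-* : ∀ x y → ι x ℚ.* ι y ≡ ι (x * y)
  ι-* x y = ι-*-/ x y 1

  ι-cancel : ∀ x d .{{_ : ℕ.NonZero d}} → (+ d * x) ℚ./ d ≡ ι x
  ι-cancel x d@(suc _) = ℚ.toℚᵘ-injective (begin
    toℚᵘ ((+ d * x) ℚ./ d)   ≈⟨ toℚᵘ-/ (+ d * x) d ⟩
    (+ d * x) ℚᵘ./ d         ≈⟨ ℚᵘ.*≡* (swap (+ d) x) ⟩
    x ℚᵘ./ 1                 ≈⟨ toℚᵘ-/ x 1 ⟨
    toℚᵘ (ι x)               ∎)
    where
    open ℚᵘ.≃-Reasoning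
    swap : ∀ d x → d * x * 1ℤ ≡ x * d
    swap = solve-∀

  ι-∑ : ∀ {n} (f : Fin n → ℤ) → ℚ∑.sum (ι ∘ f) ≡ ι (sum f)
  ι-∑ {zero}  f = refl
  ι-∑ {suc n} f = trans (cong (ι (f Fin.zero) ℚ.+_) (ι-∑ (f ∘ Fin.suc)))
                        (ι-+ (f Fin.zero) (sum (f ∘ Fin.suc)))

  !-egf : ∀ a n → ι (+ (n !)) ℚ.* egf a n ≡ ι (a n)
  !-egf a n = trans (ι-*-/ (+ (n !)) (a n) (n !) {{n ℕ.!≢0}}) (ι-cancel (a n) (n !) {{n ℕ.!≢0}})

  C-! : ∀ {n k} → k ≤ n → (n C k) ℕ.* (k ! ℕ.* (n ∸ k) !) ≡ n !
  C-! {n} {k} k≤n = trans (cong (ℕ._* (k ! ℕ.* (n ∸ k) !)) (nCk≡n!/k![n-k]! k≤n))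
                          (m/n*n≡m {{k ℕ.!* (n ∸ k) !≢0}} (k![n∸k]!∣n! k≤n))

  -- Multiplication by cos on integer sequences.

  timesCosTerm : (ℕ → ℤ) → ℕ → ℕ → ℤ
  timesCosTerm a n k = + (n C k) * a k * cos⁽ n ∸ k ⁾

  -- n! times the n-th coefficient of egf a · cos
  timesCos : (ℕ → ℤ) → ℕ → ℤ
  timesCos a n = ∑[ k ≤ n ] timesCosTerm a n (toℕ k)

  -- Multiplying the n-th coefficient of tan · cos = sin by n! clears every denominator, as n! = (n
  -- C k) k! (n - k)!. Injectivity of `ι` then carries the identity back to ℤ, where it can be
  -- reduced modulo p.
  tangent-timesCos : ∀ {T} → IsTangentNumbers T → ∀ n → timesCos T n ≡ sin⁽ n ⁾
  tangent-timesCos {T} isTan n = ι-injective (begin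
    ι (timesCos T n)
      ≡⟨ ι-∑ {suc n} (timesCosTerm T n ∘ toℕ) ⟨
    ℚ∑.sum {suc n} (ι ∘ timesCosTerm T n ∘ toℕ)
      ≡⟨ ℚ∑.sum-cong-≗ {suc n} (λ k → term (toℕ k) (ℕ.≤-pred (toℕ<n k))) ⟩
    ℚ∑.sum {suc n} (λ k → ι (+ (n !)) ℚ.* (egf T (toℕ k) ℚ.* cos (n ∸ toℕ k)))
      ≡⟨ ℚ∑.*-distribˡ-sum {suc n} (ι (+ (n !))) (λ k → egf T (toℕ k) ℚ.* cos (n ∸ toℕ k)) ⟨
    ι (+ (n !)) ℚ.* (egf T · cos) n
      ≡⟨ cong (ι (+ (n !)) ℚ.*_) (isTan n) ⟩
    ι (+ (n !)) ℚ.* sin n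
      ≡⟨ !-egf sin⁽_⁾ n ⟩
    ι sin⁽ n ⁾ ∎)
    where
    open ≡-Reasoning
    term : ∀ k → k ≤ n → ι (timesCosTerm T n k) ≡ ι (+ (n !)) ℚ.* (egf T k ℚ.* cos (n ∸ k))
    term k k≤n = begin
      ι (c * T k * cos⁽ l ⁾)
        ≡⟨ cong ι (ℤ.*-assoc c (T k) cos⁽ l ⁾) ⟩
      ι (c * (T k * cos⁽ l ⁾))
        ≡⟨ ι-* c _ ⟨
      ι c ℚ.* ι (T k * cos⁽ l ⁾)
        ≡⟨ cong (ι c ℚ.*_) (ι-* (T k) _) ⟨
      ι c ℚ.* (ι (T k) ℚ.* ι cos⁽ l ⁾)
        ≡⟨ cong (ι c ℚ.*_) (cong₂ ℚ._*_ (!-egf T k) (!-egf cos⁽_⁾ l)) ⟨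
      ι c ℚ.* ((ι (+ (k !)) ℚ.* egf T k) ℚ.* (ι (+ (l !)) ℚ.* cos l))
        ≡⟨ cong (ι c ℚ.*_) (interchange (ι (+ (k !))) _ _ _) ⟩
      ι c ℚ.* ((ι (+ (k !)) ℚ.* ι (+ (l !))) ℚ.* (egf T k ℚ.* cos l))
        ≡⟨ ℚ.*-assoc (ι c) _ _ ⟨
      ι c ℚ.* (ι (+ (k !)) ℚ.* ι (+ (l !))) ℚ.* (egf T k ℚ.* cos l)
        ≡⟨ cong (ℚ._* (egf T k ℚ.* cos l)) factorials ⟩
      ι (+ (n !)) ℚ.* (egf T k ℚ.* cos l) ∎
      where
      c = + (n C k)
      l = n ∸ k
      factorials : ι c ℚ.* (ι (+ (k !)) ℚ.* ι (+ (l !))) ≡ ι (+ (n !))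
      factorials = begin
        ι c ℚ.* (ι (+ (k !)) ℚ.* ι (+ (l !)))  ≡⟨ cong (ι c ℚ.*_) (ι-* (+ (k !)) (+ (l !))) ⟩
        ι c ℚ.* ι (+ (k !) * + (l !))          ≡⟨ ι-* c _ ⟩
        ι (c * (+ (k !) * + (l !)))            ≡⟨ cong (ι ∘ (c *_)) (ℤ.pos-* (k !) (l !)) ⟨
        ι (c * + (k ! ℕ.* l !))                ≡⟨ cong ι (ℤ.pos-* (n C k) _) ⟨
        ι (+ ((n C k) ℕ.* (k ! ℕ.* l !)))      ≡⟨ cong (ι ∘ +_) (C-! k≤n) ⟩
        ι (+ (n !))                            ∎

  -- The term k = n has binomial coefficient 1 and cos⁽ 0 ⁾ = 1, so `a n` enters with coefficient 1
  -- and can be solved for without division.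
  timesCos-last : ∀ a n → timesCos a n ≡ ∑[ k < n ] timesCosTerm a n (toℕ k) + a n
  timesCos-last a n = begin
    timesCos a n
      ≡⟨ sum-init-last {n} (timesCosTerm a n ∘ toℕ) ⟩
    ∑[ k < n ] timesCosTerm a n (toℕ (inject₁ k)) + timesCosTerm a n (toℕ (fromℕ n))
      ≡⟨ cong₂ _+_ (sum-cong-≗ {n} λ k → cong (timesCosTerm a n) (toℕ-inject₁ k))
                   (cong (timesCosTerm a n) (toℕ-fromℕ n)) ⟩
    ∑[ k < n ] timesCosTerm a n (toℕ k) + timesCosTerm a n n
      ≡⟨ cong (λ t → ∑[ k < n ] timesCosTerm a n (toℕ k) + t)
              (trans (cong₂ (λ c l → + c * a n * cos⁽ l ⁾) (nCn≡1 n) (ℕ.n∸n≡0 n)) (units (a n))) ⟩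
    ∑[ k < n ] timesCosTerm a n (toℕ k) + a n ∎
    where
    open ≡-Reasoning
    units : ∀ x → 1ℤ * x * 1ℤ ≡ x
    units = solve-∀

  -- Linearity, which lets a combination of sines be multiplied by cos one sine at a time.
  timesCos-∑ : ∀ h (w : ℕ → ℤ) (a : ℕ → ℕ → ℤ) n →
    timesCos (λ k → ∑[ i < h ] (w (toℕ i) * a (toℕ i) k)) n ≡ ∑[ i < h ] (w (toℕ i) * timesCos (a (toℕ i)) n)
  timesCos-∑ h w a n = begin
    ∑[ k ≤ n ] (c k * ∑[ i < h ] (w (toℕ i) * a (toℕ i) (toℕ k)) * d k)
      ≡⟨ sum-cong-≗ {suc n} (λ k → trans (rotate (c k) _ (d k)) 
           (*-distribˡ-sum {h} (c k * d k) (λ i → w (toℕ i) * a (toℕ i) (toℕ k)))) ⟩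
    ∑[ k ≤ n ] ∑[ i < h ] (c k * d k * (w (toℕ i) * a (toℕ i) (toℕ k)))
      ≡⟨ ∑-comm {suc n} {h} (λ k i → c k * d k * (w (toℕ i) * a (toℕ i) (toℕ k))) ⟩
    ∑[ i < h ] ∑[ k ≤ n ] (c k * d k * (w (toℕ i) * a (toℕ i) (toℕ k)))
      ≡⟨ sum-cong-≗ {h} (λ i → trans
           (sum-cong-≗ {suc n} (λ k → collect (c k) (d k) (w (toℕ i)) (a (toℕ i) (toℕ k))))
           (sym (*-distribˡ-sum {suc n} (w (toℕ i)) (timesCosTerm (a (toℕ i)) n ∘ toℕ)))) ⟩
    ∑[ i < h ] (w (toℕ i) * timesCos (a (toℕ i)) n) ∎
    where
    open ≡-Reasoning
    c d : Fin (suc n) → ℤ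
    c k = + (n C toℕ k)
    d k = cos⁽ n ∸ toℕ k ⁾
    rotate : ∀ c x d → c * x * d ≡ c * d * x
    rotate = solve-∀
    collect : ∀ c d w x → c * d * (w * x) ≡ w * (c * x * d)
    collect = solve-∀

  -- Telescoping sums and the binomial theorem.

  telescope : ∀ n (g : ℕ → ℤ) → ∑[ i < n ] (g (toℕ i) - g (suc (toℕ i))) ≡ g 0 - g n
  telescope zero    g = sym (ℤ.+-inverseʳ (g 0))
  telescope (suc n) g = trans (cong (λ s → g 0 - g 1 + s) (telescope n (g ∘ suc)))
                              (join (g 0) (g 1) (g (suc n)))
    where
    join : ∀ x y z → x - y + (y - z) ≡ x - z
    join = solve-∀

  binomial-theorem : ∀ n x y →
    (x + y) ^ n ≡ ∑[ k ≤ n ] (+ (n C toℕ k) * (x ^ toℕ k * y ^ (n ∸ toℕ k)))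
  binomial-theorem n x y = begin
    (x + y) ^ n
      ≡⟨ ^-raw (x + y) n ⟨
    (x + y) Raw.^ n
      ≡⟨ Binomial.theorem n x y ⟩
    ∑[ k ≤ n ] ((n C toℕ k) Raw.× (x Raw.^ toℕ k * y Raw.^ (n ∸ toℕ k)))
      ≡⟨ sum-cong-≗ {suc n} (λ k → trans (×-raw (n C toℕ k) _)
           (cong (+ (n C toℕ k) *_) (cong₂ _*_ (^-raw x (toℕ k)) (^-raw y (n ∸ toℕ k))))) ⟩
    ∑[ k ≤ n ] (+ (n C toℕ k) * (x ^ toℕ k * y ^ (n ∸ toℕ k))) ∎
    where
    open ≡-Reasoning
    ^-raw : ∀ x n → x Raw.^ n ≡ x ^ n
    ^-raw x zero    = refl
    ^-raw x (suc n) = cong (x *_) (^-raw x n)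
    succ : ∀ n x → x + n * x ≡ (1ℤ + n) * x
    succ = solve-∀
    ×-raw : ∀ n x → n Raw.× x ≡ + n * x
    ×-raw zero    x = refl
    ×-raw (suc n) x = trans (cong (λ t → x + t) (×-raw n x)) (succ (+ n) x)

  -- Signs and the derivatives of sine and cosine at 0.

  neg-^ : ∀ x n → (- x) ^ n ≡ -1ℤ ^ n * x ^ n
  neg-^ x zero    = refl
  neg-^ x (suc n) = trans (cong (- x *_) (neg-^ x n)) (signs x (-1ℤ ^ n) (x ^ n))
    where
    signs : ∀ x e y → - x * (e * y) ≡ -1ℤ * e * (x * y)
    signs = solve-∀

  [-1]^-square : ∀ n → -1ℤ ^ n * -1ℤ ^ n ≡ 1ℤ
  [-1]^-square zero    = refl
  [-1]^-square (suc n) = trans (signs (-1ℤ ^ n)) ([-1]^-square n)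
    where
    signs : ∀ e → -1ℤ * e * (-1ℤ * e) ≡ e * e
    signs = solve-∀

  -- For odd l both sides vanish. For even l the factor 1 + (-1)^l is 2, and shifting the index of
  -- sin by l multiplies by (-1)^(l/2), which is cos⁽ l ⁾. The induction goes in steps of two, each
  -- negating both sides.
  sin-cos : ∀ k l → + 2 * (sin⁽ k ⁾ * cos⁽ l ⁾) ≡ sin⁽ k ℕ.+ l ⁾ * (1ℤ + -1ℤ ^ l)
  sin-cos zero zero = refl
  sin-cos zero (suc zero) = refl
  sin-cos zero (suc (suc l)) = trans (lhs cos⁽ l ⁾) (trans (cong -_ (sin-cos 0 l)) (rhs sin⁽ l ⁾ (-1ℤ ^ l)))
    where
    lhs : ∀ c → + 2 * (0ℤ * - c) ≡ - (+ 2 * (0ℤ * c))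
    lhs = solve-∀
    rhs : ∀ b e → - (b * (1ℤ + e)) ≡ - b * (1ℤ + -1ℤ * (-1ℤ * e))
    rhs = solve-∀
  sin-cos (suc zero) zero = refl
  sin-cos (suc zero) (suc zero) = refl
  sin-cos (suc zero) (suc (suc l)) = trans (lhs cos⁽ l ⁾) (trans (cong -_ (sin-cos 1 l)) (rhs sin⁽ suc l ⁾ (-1ℤ ^ l)))
    where
    lhs : ∀ c → + 2 * (1ℤ * - c) ≡ - (+ 2 * (1ℤ * c))
    lhs = solve-∀
    rhs : ∀ b e → - (b * (1ℤ + e)) ≡ - b * (1ℤ + -1ℤ * (-1ℤ * e))
    rhs = solve-∀
  sin-cos (suc (suc k)) l = trans (lhs sin⁽ k ⁾ cos⁽ l ⁾) (trans (cong -_ (sin-cos k l)) (rhs sin⁽ k ℕ.+ l ⁾ (-1ℤ ^ l)))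
    where
    lhs : ∀ a c → + 2 * (- a * c) ≡ - (+ 2 * (a * c))
    lhs = solve-∀
    rhs : ∀ b e → - (b * (1ℤ + e)) ≡ - b * (1ℤ + e)
    rhs = solve-∀

  -- Sine is odd: its derivatives at 0 of even order vanish, and for odd n the power is -1.
  sin-[-1]^ : ∀ n → sin⁽ n ⁾ * -1ℤ ^ n ≡ - sin⁽ n ⁾
  sin-[-1]^ 0 = refl
  sin-[-1]^ 1 = refl
  sin-[-1]^ (suc (suc n)) = trans (signs sin⁽ n ⁾ (-1ℤ ^ n)) (cong -_ (sin-[-1]^ n))
    where
    signs : ∀ s e → - s * (-1ℤ * (-1ℤ * e)) ≡ - (s * e)
    signs = solve-∀

  -- The coefficients of sin (0 z). At n = 0 the power is 1, and it is sin⁽ 0 ⁾ that vanishes.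
  sin-0^ : ∀ n → sin⁽ n ⁾ * 0ℤ ^ n ≡ 0ℤ
  sin-0^ zero    = refl
  sin-0^ (suc n) = ℤ.*-zeroʳ sin⁽ suc n ⁾

  -- 2 sin (x z) cos z = sin ((x + 1) z) + sin ((x − 1) z)
  sin-scaled-timesCos : ∀ x n → + 2 * timesCos (λ k → sin⁽ k ⁾ * x ^ k) n ≡
    sin⁽ n ⁾ * ((x + 1ℤ) ^ n + (x + -1ℤ) ^ n)
  sin-scaled-timesCos x n = begin
    + 2 * timesCos a n
      ≡⟨ *-distribˡ-sum {suc n} (+ 2) (timesCosTerm a n ∘ toℕ) ⟩
    ∑[ k ≤ n ] (+ 2 * timesCosTerm a n (toℕ k))
      ≡⟨ sum-cong-≗ {suc n} (λ k → term (toℕ k) (ℕ.≤-pred (toℕ<n k))) ⟩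
    ∑[ k ≤ n ] (sin⁽ n ⁾ * (b 1ℤ (toℕ k) + b -1ℤ (toℕ k)))
      ≡⟨ *-distribˡ-sum {suc n} sin⁽ n ⁾ (λ k → b 1ℤ (toℕ k) + b -1ℤ (toℕ k)) ⟨
    sin⁽ n ⁾ * ∑[ k ≤ n ] (b 1ℤ (toℕ k) + b -1ℤ (toℕ k))
      ≡⟨ cong (sin⁽ n ⁾ *_) (∑-distrib-+ {suc n} (b 1ℤ ∘ toℕ) (b -1ℤ ∘ toℕ)) ⟩
    sin⁽ n ⁾ * (∑[ k ≤ n ] b 1ℤ (toℕ k) + ∑[ k ≤ n ] b -1ℤ (toℕ k))
      ≡⟨ cong (sin⁽ n ⁾ *_) (cong₂ _+_ (binomial-theorem n x 1ℤ) (binomial-theorem n x -1ℤ)) ⟨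
    sin⁽ n ⁾ * ((x + 1ℤ) ^ n + (x + -1ℤ) ^ n) ∎
    where
    open ≡-Reasoning
    a : ℕ → ℤ
    a k = sin⁽ k ⁾ * x ^ k
    b : ℤ → ℕ → ℤ
    b y k = + (n C k) * (x ^ k * y ^ (n ∸ k))
    pull : ∀ c s y d → + 2 * (c * (s * y) * d) ≡ + 2 * (s * d) * (c * y)
    pull = solve-∀
    push : ∀ s e c y → s * (1ℤ + e) * (c * y) ≡ s * (c * (y * 1ℤ) + c * (y * e))
    push = solve-∀
    term : ∀ k → k ≤ n → + 2 * timesCosTerm a n k ≡ sin⁽ n ⁾ * (b 1ℤ k + b -1ℤ k)
    term k k≤n = begin
      + 2 * (c * (sin⁽ k ⁾ * x ^ k) * cos⁽ l ⁾)          ≡⟨ pull c sin⁽ k ⁾ (x ^ k) cos⁽ l ⁾ ⟩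
      + 2 * (sin⁽ k ⁾ * cos⁽ l ⁾) * (c * x ^ k)          ≡⟨ cong (_* (c * x ^ k)) (sin-cos k l) ⟩
      sin⁽ k ℕ.+ l ⁾ * (1ℤ + -1ℤ ^ l) * (c * x ^ k)
        ≡⟨ cong (λ m → sin⁽ m ⁾ * (1ℤ + -1ℤ ^ l) * (c * x ^ k)) (ℕ.m+[n∸m]≡n k≤n) ⟩
      sin⁽ n ⁾ * (1ℤ + -1ℤ ^ l) * (c * x ^ k)            ≡⟨ push sin⁽ n ⁾ (-1ℤ ^ l) c (x ^ k) ⟩
      sin⁽ n ⁾ * (c * (x ^ k * 1ℤ) + b -1ℤ k)
        ≡⟨ cong (λ o → sin⁽ n ⁾ * (c * (x ^ k * o) + b -1ℤ k)) (ℤ.^-zeroˡ l) ⟨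
      sin⁽ n ⁾ * (b 1ℤ k + b -1ℤ k) ∎
      where
      c = + (n C k)
      l = n ∸ k
  n∣n! : ∀ {n} → 0 < n → n ℕ∣.∣ n !
  n∣n! {suc n} _ = ℕ∣.m∣m*n (n !)

  -- The polynomial Σ m xᵐ over 1 ≤ m ≤ n, which is P for n = p - 1.

  moment : ℕ → ℤ → ℤ
  moment n x = ∑[ i < n ] (+ suc (toℕ i) * x ^ suc (toℕ i))

  -- With x = 1 + y, the usual closed form has denominator (x - 1)² = y². Multiplying it out keeps
  -- the identity in ℤ.
  moment-closed : ∀ n y → y * y * moment n (1ℤ + y) ≡
    + n * (1ℤ + y) ^ suc n * y - (1ℤ + y) ^ suc n + (1ℤ + y)
  moment-closed n y = begin
    y * y * moment n x
      ≡⟨ *-distribˡ-sum {n} (y * y) (λ i → + suc (toℕ i) * x ^ suc (toℕ i)) ⟩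
    ∑[ i < n ] (y * y * (+ suc (toℕ i) * x ^ suc (toℕ i)))
      ≡⟨ sum-cong-≗ {n} (λ i → step (+ (toℕ i)) y (x ^ suc (toℕ i))) ⟩
    ∑[ i < n ] (g (toℕ i) - g (suc (toℕ i)))
      ≡⟨ telescope n g ⟩
    g 0 - g n
      ≡⟨ ends (+ n) y (x ^ suc n) ⟩
    + n * x ^ suc n * y - x ^ suc n + x ∎
    where
    open ≡-Reasoning
    x = 1ℤ + y
    g : ℕ → ℤ
    -- An antidifference: `g i - g (suc i)` is y² (i + 1) x^(i+1).
    g i = x ^ suc i - + i * x ^ suc i * y
    step : ∀ i y z → y * y * ((1ℤ + i) * z) ≡
      (z - i * z * y) - ((1ℤ + y) * z - (1ℤ + i) * ((1ℤ + y) * z) * y)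
    step = solve-∀
    ends : ∀ n y z → ((1ℤ + y) * 1ℤ - 0ℤ * ((1ℤ + y) * 1ℤ) * y) - (z - n * z * y) ≡ n * z * y - z + (1ℤ + y)
    ends = solve-∀

  -- At x = 1 `moment-closed` degenerates to 0 = 0, so the value is found separately, as a doubled
  -- triangular number.
  moment-1 : ∀ n → + 2 * moment n 1ℤ ≡ + n * (1ℤ + + n)
  moment-1 n = begin
    + 2 * moment n 1ℤ
      ≡⟨ *-distribˡ-sum {n} (+ 2) (λ i → + suc (toℕ i) * 1ℤ ^ suc (toℕ i)) ⟩
    ∑[ i < n ] (+ 2 * (+ suc (toℕ i) * 1ℤ ^ suc (toℕ i)))
      ≡⟨ sum-cong-≗ {n} (λ i → trans
           (cong (λ o → + 2 * (+ suc (toℕ i) * o)) (ℤ.^-zeroˡ (suc (toℕ i)))) (step (+ toℕ i))) ⟩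
    ∑[ i < n ] (g (toℕ i) - g (suc (toℕ i)))
      ≡⟨ telescope n g ⟩
    0ℤ - g n
      ≡⟨ ends (+ n) ⟩
    + n * (1ℤ + + n) ∎
    where
    open ≡-Reasoning
    g : ℕ → ℤ
    g i = - (+ i * (1ℤ + + i))
    step : ∀ i → + 2 * ((1ℤ + i) * 1ℤ) ≡ - (i * (1ℤ + i)) - - ((1ℤ + i) * (1ℤ + (1ℤ + i)))
    step = solve-∀
    ends : ∀ n → 0ℤ - - (n * (1ℤ + n)) ≡ n * (1ℤ + n)
    ends = solve-∀

  -- Parity of the index.

  [-1]^-even : ∀ m → 2 ℕ∣.∣ m → -1ℤ ^ m ≡ 1ℤ
  [-1]^-even zero          _   = refl
  [-1]^-even (suc zero)    2∣1 = contradiction 2∣1 (ℕ∣.>⇒∤ (s<s z<s))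
  [-1]^-even (suc (suc m)) 2∣m = trans (square (-1ℤ ^ m)) ([-1]^-even m (ℕ∣.∣m+n∣m⇒∣n 2∣m ℕ∣.∣-refl))
    where
    square : ∀ s → -1ℤ * (-1ℤ * s) ≡ s
    square = solve-∀

  [-1]^-odd : ∀ m → ¬ 2 ℕ∣.∣ m → -1ℤ ^ m ≡ -1ℤ
  [-1]^-odd zero          2∤0 = contradiction (2 ℕ∣.∣0) 2∤0
  [-1]^-odd (suc zero)    _   = refl
  [-1]^-odd (suc (suc m)) 2∤m = trans (square (-1ℤ ^ m)) ([-1]^-odd m (2∤m ∘ ℕ∣.∣m∣n⇒∣m+n ℕ∣.∣-refl))
    where
    square : ∀ s → -1ℤ * (-1ℤ * s) ≡ s
    square = solve-∀

  -- For m = 2j + 1 the derivative is (-1)^j and the sign in the theorem is (-1)^(j+1), so the two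
  -- cancel up to a constant -1.
  sin-odd : ∀ m → ¬ 2 ℕ∣.∣ m → -1ℤ ^ ((m ℕ.+ 1) / 2) * sin⁽ m ⁾ ≡ -1ℤ
  sin-odd zero          2∤0 = contradiction (2 ℕ∣.∣0) 2∤0
  sin-odd (suc zero)    _   = refl
  sin-odd (suc (suc m)) 2∤m = begin
    -1ℤ ^ ((2 ℕ.+ (m ℕ.+ 1)) / 2) * - sin⁽ m ⁾
      ≡⟨ cong (λ k → -1ℤ ^ k * - sin⁽ m ⁾) (+-distrib-/-∣ˡ (m ℕ.+ 1) (ℕ∣.∣-refl {2})) ⟩
    -1ℤ * -1ℤ ^ ((m ℕ.+ 1) / 2) * - sin⁽ m ⁾
      ≡⟨ signs (-1ℤ ^ ((m ℕ.+ 1) / 2)) sin⁽ m ⁾ ⟩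
    -1ℤ ^ ((m ℕ.+ 1) / 2) * sin⁽ m ⁾
      ≡⟨ sin-odd m (2∤m ∘ ℕ∣.∣m∣n⇒∣m+n ℕ∣.∣-refl) ⟩
    -1ℤ ∎
    where
    open ≡-Reasoning
    signs : ∀ e s → -1ℤ * e * - s ≡ e * s
    signs = solve-∀

  sumOver-applyUpTo : ∀ n (g : ℕ → ℕ) f → sumOver (applyUpTo g n) f ≡ ∑[ i < n ] f (g (toℕ i))
  sumOver-applyUpTo zero    g f = refl
  sumOver-applyUpTo (suc n) g f = cong (λ s → f (g 0) + s) (sumOver-applyUpTo n (g ∘ suc) f)

-- Congruences modulo p.

module Modulo (p : ℕ) where
  open import Data.Integer using (_+_; _-_; -_; -[1+_])

  infix 4 _≈_

  -- A record keeps both sides visible in the type; they could not be inferred from the difference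
  -- `a - b` alone.
  record _≈_ (a b : ℤ) : Set where
    constructor congruent
    field difference : + p ℤ∣.∣ a - b
  open _≈_ public

  private
    difference-≡ : ∀ {a b c} → a - b ≡ c → + p ℤ∣.∣ c → a ≈ b
    difference-≡ eq p∣c = congruent (subst (+ p ℤ∣.∣_) (sym eq) p∣c)

  ≈-refl : ∀ {a} → a ≈ a
  ≈-refl {a} = congruent (ℤ∣.divides 0ℤ (ℤ.+-inverseʳ a))

  ≈-reflexive : ∀ {a b} → a ≡ b → a ≈ b
  ≈-reflexive refl = ≈-refl

  ≈-sym : ∀ {a b} → a ≈ b → b ≈ a
  ≈-sym {a} {b} (congruent d) = difference-≡ (flip b a) (ℤ∣.∣m⇒∣-m d)
    where
    flip : ∀ b a → b - a ≡ - (a - b)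
    flip = solve-∀

  ≈-trans : ∀ {a b c} → a ≈ b → b ≈ c → a ≈ c
  ≈-trans {a} {b} {c} (congruent d) (congruent e) = difference-≡ (split a b c) (ℤ∣.∣m∣n⇒∣m+n d e)
    where
    split : ∀ a b c → a - c ≡ (a - b) + (b - c)
    split = solve-∀

  setoid : Setoid _ _
  setoid = record
    { _≈_ = _≈_
    ; isEquivalence = record { refl = ≈-refl ; sym = ≈-sym ; trans = ≈-trans }
    }

  open import Relation.Binary.Reasoning.Setoid setoid

  +-cong : ∀ {a b c d} → a ≈ b → c ≈ d → a + c ≈ b + d
  +-cong {a} {b} {c} {d} (congruent e) (congruent f) = difference-≡ (split a b c d) (ℤ∣.∣m∣n⇒∣m+n e f)
    where
    split : ∀ a b c d → (a + c) - (b + d) ≡ (a - b) + (c - d)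
    split = solve-∀

  *-cong : ∀ {a b c d} → a ≈ b → c ≈ d → a * c ≈ b * d
  *-cong {a} {b} {c} {d} (congruent e) (congruent f) =
    difference-≡ (split a b c d) (ℤ∣.∣m∣n⇒∣m+n (ℤ∣.∣m⇒∣m*n c e) (ℤ∣.∣n⇒∣m*n b f))
    where
    split : ∀ a b c d → a * c - b * d ≡ (a - b) * c + b * (c - d)
    split = solve-∀

  +-congˡ : ∀ a {b c} → b ≈ c → a + b ≈ a + c
  +-congˡ a = +-cong (≈-refl {a})

  +-congʳ : ∀ a {b c} → b ≈ c → b + a ≈ c + a
  +-congʳ a b≈c = +-cong b≈c (≈-refl {a})

  *-congˡ : ∀ a {b c} → b ≈ c → a * b ≈ a * c
  *-congˡ a = *-cong (≈-refl {a})

  *-congʳ : ∀ a {b c} → b ≈ c → b * a ≈ c * a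
  *-congʳ a b≈c = *-cong b≈c (≈-refl {a})

  neg-cong : ∀ {a b} → a ≈ b → - a ≈ - b
  neg-cong {a} {b} (congruent d) = difference-≡ (split a b) (ℤ∣.∣m⇒∣-m d)
    where
    split : ∀ a b → - a - - b ≡ - (a - b)
    split = solve-∀

  ^-cong : ∀ n {a b} → a ≈ b → a ^ n ≈ b ^ n
  ^-cong zero    a≈b = ≈-refl
  ^-cong (suc n) a≈b = *-cong a≈b (^-cong n a≈b)

  ∑-cong : ∀ {n} {f g : Fin n → ℤ} → (∀ i → f i ≈ g i) → sum f ≈ sum g
  ∑-cong {zero}  f≈g = ≈-refl
  ∑-cong {suc n} f≈g = +-cong (f≈g Fin.zero) (∑-cong (f≈g ∘ Fin.suc))

  ∣⇒≈0 : ∀ {a} → + p ℤ∣.∣ a → a ≈ 0ℤ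
  ∣⇒≈0 {a} = difference-≡ (ℤ.+-identityʳ a)

  -- Meant for the binomial expansion of a p-th power, whose inner terms vanish; 0 < n keeps the two
  -- ends distinct.
  ∑-ends : ∀ {n} (f : ℕ → ℤ) → 0 < n → (∀ {k} → 0 < k → k < n → f k ≈ 0ℤ) →
           ∑[ k ≤ n ] f (toℕ k) ≈ f 0 + f n
  ∑-ends {suc n} f _ f≈0 = +-congˡ (f 0) (begin
    ∑[ k ≤ n ] f (suc (toℕ k))
      ≡⟨ sum-init-last {n} (f ∘ suc ∘ toℕ) ⟩
    ∑[ k < n ] f (suc (toℕ (inject₁ k))) + f (suc (toℕ (fromℕ n)))
      ≡⟨ cong₂ _+_ (sum-cong-≗ {n} (λ k → cong (f ∘ suc) (toℕ-inject₁ k))) (cong (f ∘ suc) (toℕ-fromℕ n)) ⟩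
    ∑[ k < n ] f (suc (toℕ k)) + f (suc n)
      ≈⟨ +-congʳ (f (suc n)) (∑-cong {n} (λ k → f≈0 z<s (s<s (toℕ<n k)))) ⟩
    ∑[ k < n ] 0ℤ + f (suc n)
      ≡⟨ cong (λ s → s + f (suc n)) (sum-replicate-zero n) ⟩
    0ℤ + f (suc n)
      ≡⟨ ℤ.+-identityˡ (f (suc n)) ⟩
    f (suc n) ∎)

  -- The defect `d` at i = 0 accommodates the one place where the oddness of `G` fails.
  telescope-≈ : ∀ {n} {f : ℕ → ℤ} (g : ℕ → ℤ) {d} → 0 < n → f 0 ≈ g 0 - g 1 + d →
    (∀ {i} → 0 < i → i < n → f i ≈ g i - g (suc i)) → ∑[ i < n ] f (toℕ i) ≈ g 0 - g n + d
  telescope-≈ {suc n} {f} g {d} _ f0 fi = begin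
    f 0 + ∑[ i < n ] f (suc (toℕ i))
      ≈⟨ +-cong f0 (∑-cong {n} (λ i → fi z<s (s<s (toℕ<n i)))) ⟩
    g 0 - g 1 + d + ∑[ i < n ] (g (suc (toℕ i)) - g (suc (suc (toℕ i))))
      ≡⟨ cong (λ s → g 0 - g 1 + d + s) (telescope n (g ∘ suc)) ⟩
    g 0 - g 1 + d + (g 1 - g (suc n))
      ≡⟨ join (g 0) (g 1) d (g (suc n)) ⟩
    g 0 - g (suc n) + d ∎
    where
    join : ∀ x y d z → x - y + d + (y - z) ≡ x - z + d
    join = solve-∀

  sumOver-filter : ∀ {P : ℕ → Set} (P? : Decidable P) ms {f g : ℕ → ℤ} →
    (∀ m → P m → f m ≈ g m) → (∀ m → ¬ P m → 0ℤ ≈ g m) → sumOver (filter P? ms) f ≈ sumOver ms g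
  sumOver-filter P? []       f≈g 0≈g = ≈-refl
  sumOver-filter P? (m ∷ ms) {f} {g} f≈g 0≈g with P? m
  ... | yes Pm = +-cong (f≈g m Pm) (sumOver-filter P? ms f≈g 0≈g)
  ... | no ¬Pm = ≈-trans (≈-reflexive (sym (ℤ.+-identityˡ (sumOver (filter P? ms) f))))
                         (+-cong (0≈g m ¬Pm) (sumOver-filter P? ms f≈g 0≈g))

  -- The factor 1 - (-1)^m is 2 for odd m and 0 for even m. It extends the sum to all m, so that
  -- full moments can appear.
  sumOver-odds : ∀ n {f e : ℕ → ℤ} → (∀ m → ¬ 2 ℕ∣.∣ m → f m ≈ + 2 * e m) →
    sumOver (oddsUpTo n) f ≈ ∑[ i < n ] ((1ℤ - -1ℤ ^ suc (toℕ i)) * e (suc (toℕ i)))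
  sumOver-odds n {f} {e} f≈2e = begin
    sumOver (oddsUpTo n) f
      ≈⟨ sumOver-filter (λ m → ¬? (2 ℕ∣.∣? m)) (applyUpTo suc n) odd even ⟩
    sumOver (applyUpTo suc n) g
      ≡⟨ sumOver-applyUpTo n suc g ⟩
    ∑[ i < n ] g (suc (toℕ i)) ∎
    where
    g : ℕ → ℤ
    g m = (1ℤ - -1ℤ ^ m) * e m
    odd : ∀ m → ¬ 2 ℕ∣.∣ m → f m ≈ g m
    odd m 2∤m = ≈-trans (f≈2e m 2∤m) (≈-reflexive (cong (λ s → (1ℤ - s) * e m) (sym ([-1]^-odd m 2∤m))))
    even : ∀ m → ¬ ¬ 2 ℕ∣.∣ m → 0ℤ ≈ g m
    even m ¬2∤m = ≈-reflexive (sym (cong (λ s → (1ℤ - s) * e m)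
      ([-1]^-even m (decidable-stable (2 ℕ∣.∣? m) ¬2∤m))))

  -- cos has constant term 1, so the coefficients are determined recursively.
  timesCos-injective : ∀ {a b} → (∀ n → timesCos a n ≈ timesCos b n) → ∀ n → a n ≈ b n
  timesCos-injective {a} {b} eq = <-rec _ λ n ih → begin
    a n                                   ≡⟨ isolate a n ⟩
    timesCos a n + - initial a n          ≈⟨ +-cong (eq n) (neg-cong (∑-cong {n} λ k →
      *-congʳ cos⁽ n ∸ toℕ k ⁾ (*-congˡ (+ (n C toℕ k)) (ih (toℕ<n k))))) ⟩
    timesCos b n + - initial b n          ≡⟨ isolate b n ⟨
    b n                                   ∎
    where
    initial : (ℕ → ℤ) → ℕ → ℤ
    initial a n = ∑[ k < n ] timesCosTerm a n (toℕ k)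
    cancel : ∀ s x → x ≡ s + x + - s
    cancel = solve-∀
    isolate : ∀ a n → a n ≡ timesCos a n + - initial a n
    isolate a n = trans (cancel (initial a n) (a n)) (cong (λ t → t + - initial a n) (sym (timesCos-last a n)))

  -- Prime moduli: cancellation, Frobenius and Fermat.

  module _ (p-prime : Prime p) where

    0<p : 0 < p
    0<p = ℕ.>-nonZero⁻¹ p {{prime⇒nonZero p-prime}}

    *-cancelˡ : ∀ {c a b} → ¬ + p ℤ∣.∣ c → c * a ≈ c * b → a ≈ b
    *-cancelˡ {c} {a} {b} p∤c (congruent d)
      with euclidsLemma ℤ.∣ c ∣ ℤ.∣ a - b ∣ p-prime
             (subst (p ℕ∣.∣_) (ℤ.abs-* c (a - b)) (ℤ∣.∣⇒∣ᵤ (subst (+ p ℤ∣.∣_) (factor c a b) d)))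
      where
      factor : ∀ c a b → c * a - c * b ≡ c * (a - b)
      factor = solve-∀
    ... | inj₁ p∣c = contradiction (ℤ∣.∣ᵤ⇒∣ p∣c) p∤c
    ... | inj₂ p∣a-b = congruent (ℤ∣.∣ᵤ⇒∣ p∣a-b)

    p∤k! : ∀ k → k < p → ¬ p ℕ∣.∣ k !
    p∤k! zero _ p∣1 = ¬prime[1] (subst Prime (ℕ∣.∣1⇒≡1 p∣1) p-prime)
    p∤k! (suc k) 1+k<p p∣[1+k]! with euclidsLemma (suc k) (k !) p-prime p∣[1+k]!
    ... | inj₁ p∣1+k = ℕ∣.>⇒∤ 1+k<p p∣1+k
    ... | inj₂ p∣k!  = p∤k! k (ℕ.<-trans (ℕ.n<1+n k) 1+k<p) p∣k!

    -- p divides p! = (p C k) k! (p - k)!, but neither of the two factorials, whose factors are all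
    -- below p.
    p∣pCk : ∀ {k} → 0 < k → k < p → p ℕ∣.∣ p C k
    p∣pCk {k} 0<k k<p
      with euclidsLemma (p C k) (k ! ℕ.* (p ∸ k) !) p-prime
             (subst (p ℕ∣.∣_) (sym (C-! (ℕ.<⇒≤ k<p))) (n∣n! 0<p))
    ... | inj₁ p∣C = p∣C
    ... | inj₂ p∣k![p-k]! with euclidsLemma (k !) ((p ∸ k) !) p-prime p∣k![p-k]!
    ...   | inj₁ p∣k!     = contradiction p∣k! (p∤k! k k<p)
    ...   | inj₂ p∣[p-k]! = contradiction p∣[p-k]! (p∤k! (p ∸ k) (ℕ.∸-monoʳ-< 0<k (ℕ.<⇒≤ k<p)))

    frobenius : ∀ x → (1ℤ + x) ^ p ≈ 1ℤ + x ^ p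
    frobenius x = begin
      (1ℤ + x) ^ p                ≡⟨ binomial-theorem p 1ℤ x ⟩
      ∑[ k ≤ p ] f (toℕ k)        ≈⟨ ∑-ends f 0<p (λ {k} 0<k k<p →
        *-congʳ (1ℤ ^ k * x ^ (p ∸ k)) {b = + (p C k)} (∣⇒≈0 (ℤ∣.∣ᵤ⇒∣ (p∣pCk 0<k k<p)))) ⟩
      f 0 + f p                   ≡⟨ cong (λ t → f 0 + t) (cong₂ (λ c l → + c * (1ℤ ^ p * x ^ l)) (nCn≡1 p) (ℕ.n∸n≡0 p)) ⟩
      f 0 + 1ℤ * (1ℤ ^ p * 1ℤ)    ≡⟨ cong (λ o → f 0 + 1ℤ * (o * 1ℤ)) (ℤ.^-zeroˡ p) ⟩
      f 0 + 1ℤ                    ≡⟨ tidy (x ^ p) ⟩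
      1ℤ + x ^ p                  ∎
      where
      f : ℕ → ℤ
      f k = + (p C k) * (1ℤ ^ k * x ^ (p ∸ k))
      tidy : ∀ z → 1ℤ * (1ℤ * z) + 1ℤ ≡ 1ℤ + z
      tidy = solve-∀

    -- `frobenius` passes between x and 1 + x: upwards from 0 through the naturals, downwards from 0
    -- through the negative integers.
    fermat : ∀ x → x ^ p ≈ x
    fermat (+ zero)      = ≈-reflexive (0^ 0<p)
      where
      0^ : ∀ {n} → 0 < n → 0ℤ ^ n ≡ 0ℤ
      0^ {suc n} _ = refl
    fermat (+ suc n)     = ≈-trans (frobenius (+ n)) (+-congˡ 1ℤ (fermat (+ n)))
    fermat -[1+ n ]      = begin
      -[1+ n ] ^ p                     ≡⟨ add-subtract (-[1+ n ] ^ p) ⟩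
      -1ℤ + (1ℤ + -[1+ n ] ^ p)        ≈⟨ +-congˡ -1ℤ (frobenius -[1+ n ]) ⟨
      -1ℤ + (1ℤ + -[1+ n ]) ^ p        ≈⟨ +-congˡ -1ℤ (successor n) ⟩
      -1ℤ + (1ℤ + -[1+ n ])            ≡⟨ add-subtract -[1+ n ] ⟨
      -[1+ n ]                         ∎
      where
      add-subtract : ∀ x → x ≡ -1ℤ + (1ℤ + x)
      add-subtract = solve-∀
      -- 1 + `-[1+ n ]` computes to 0 or to the preceding negative integer only once n is split,
      -- which also makes the recursion structural.
      successor : ∀ n → (1ℤ + -[1+ n ]) ^ p ≈ 1ℤ + -[1+ n ]
      successor zero    = fermat 0ℤ
      successor (suc n) = fermat -[1+ n ]

-- The neighbours of `odd i` are `even i` and `even (suc i)`, the shape that makes the sums below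
-- telescope.
even odd : ℕ → ℤ
even i = + (i ℕ.+ i)
odd i  = + suc (i ℕ.+ i)

-- The moment modulo p = 2h + 1.

module OddPrime (h : ℕ) (p-prime : Prime (suc (h ℕ.+ h))) where
  open import Data.Integer using (_+_; _-_; -_)

  p = suc (h ℕ.+ h)
  c = -1ℤ ^ h

  open Modulo p
  open import Relation.Binary.Reasoning.Setoid setoid

  0<h : 0 < h
  0<h = positive h p-prime
    where
    positive : ∀ h → Prime (suc (h ℕ.+ h)) → 0 < h
    positive zero    1-prime = contradiction 1-prime ¬prime[1]
    positive (suc h) _       = z<s

  even-h≈-1 : even h ≈ -1ℤ
  even-h≈-1 = congruent (ℤ∣.divides 1ℤ
    (trans (cong (λ n → + n) (ℕ.+-comm (h ℕ.+ h) 1)) (sym (ℤ.*-identityˡ (+ p)))))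

  -- 0 < 2i ≤ 2h < p. The case i = 1 permits cancelling 2.
  p∤even : ∀ {i} → 0 < i → i ≤ h → ¬ + p ℤ∣.∣ even i
  p∤even {suc i} _ i≤h p∣2i = ℕ∣.>⇒∤ (s≤s (ℕ.+-mono-≤ i≤h i≤h)) (ℤ∣.∣⇒∣ᵤ p∣2i)

  -- P recentred at x = 1, where its closed form has the pole.
  M : ℤ → ℤ
  M y = moment (h ℕ.+ h) (1ℤ + y)

  -- In `moment-closed` with n = p - 1 the coefficient n is ≡ -1 and x^p ≡ x by Fermat, so the terms
  -- -x^p and x cancel.
  moment-mod : ∀ y → y * y * M y ≈ - ((1ℤ + y) * y)
  moment-mod y = begin
    y * y * M y                                ≡⟨ moment-closed (h ℕ.+ h) y ⟩
    even h * x ^ p * y - x ^ p + x             ≈⟨ +-congʳ x (+-cong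
      (*-congʳ y (*-cong even-h≈-1 (fermat p-prime x))) (neg-cong (fermat p-prime x))) ⟩
    -1ℤ * x * y - x + x                        ≡⟨ tidy x y ⟩
    - (x * y)                                  ∎
    where
    x = 1ℤ + y
    tidy : ∀ x y → -1ℤ * x * y - x + x ≡ - (x * y)
    tidy = solve-∀

  -- For y ≢ 0, M y ≡ − 1 / y − 1, so the shift by 1 makes it odd.
  G : ℤ → ℤ
  G y = M y + 1ℤ

  -- Adding `moment-mod` at y and -y gives y² (M y + M (-y)) ≡ -2 y², and y may be cancelled twice.
  G-odd : ∀ {y} → ¬ + p ℤ∣.∣ y → G (- y) ≈ - G y
  G-odd {y} p∤y = ≈-trans (+-congʳ 1ℤ M-reflect) (≈-reflexive (shift (M y)))
    where
    shift : ∀ m → - (+ 2) - m + 1ℤ ≡ - (m + 1ℤ)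
    shift = solve-∀
    neg-square : ∀ y m → y * (y * m) ≡ - y * - y * m
    neg-square = solve-∀
    both : ∀ y → - ((1ℤ - y) * - y) ≡ - (+ 2) * (y * y) - - ((1ℤ + y) * y)
    both = solve-∀
    distribute : ∀ y m → - (+ 2) * (y * y) - y * y * m ≡ y * (y * (- (+ 2) - m))
    distribute = solve-∀
    M-reflect : M (- y) ≈ - (+ 2) - M y
    M-reflect = *-cancelˡ p-prime p∤y (*-cancelˡ p-prime p∤y (begin
      y * (y * M (- y))                              ≡⟨ neg-square y (M (- y)) ⟩
      - y * - y * M (- y)                            ≈⟨ moment-mod (- y) ⟩
      - ((1ℤ - y) * - y)                             ≡⟨ both y ⟩
      - (+ 2) * (y * y) - - ((1ℤ + y) * y)           ≈⟨ +-congˡ (- (+ 2) * (y * y)) (neg-cong (moment-mod y)) ⟨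
      - (+ 2) * (y * y) - y * y * M y                ≡⟨ distribute y (M y) ⟩
      y * (y * (- (+ 2) - M y))                      ∎))

  -- `moment-mod` is void at y = 0; instead 2 (1 + ⋯ + 2h) = 2h p, and 2 is cancelled.
  M-0 : M 0ℤ ≈ 0ℤ
  M-0 = *-cancelˡ p-prime (p∤even {1} z<s 0<h) (begin
    + 2 * M 0ℤ           ≡⟨ moment-1 (h ℕ.+ h) ⟩
    even h * + p         ≈⟨ ∣⇒≈0 (ℤ∣.divides (even h) refl) ⟩
    + 2 * 0ℤ             ∎)

  -- Since -2h ≡ 1, `moment-mod` at y ≡ 1 reads M y ≡ -2.
  G-even-h : G (- even h) ≈ -1ℤ
  G-even-h = +-congʳ 1ℤ (begin
    M y                      ≡⟨ units (M y) ⟩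
    1ℤ * 1ℤ * M y            ≈⟨ *-congʳ (M y) (*-cong y≈1 y≈1) ⟨
    y * y * M y              ≈⟨ moment-mod y ⟩
    - ((1ℤ + y) * y)         ≈⟨ neg-cong (*-cong (+-congˡ 1ℤ y≈1) y≈1) ⟩
    - (+ 2)                  ∎)
    where
    y = - even h
    y≈1 : y ≈ 1ℤ
    y≈1 = neg-cong even-h≈-1
    units : ∀ m → m ≡ 1ℤ * 1ℤ * m
    units = solve-∀

  -- The alternating sum of moments.

  moment-difference : ℕ → ℤ
  moment-difference i = moment (h ℕ.+ h) (- odd i) + -1ℤ * moment (h ℕ.+ h) (odd i)

  -- Recentring turns the arguments ±(2i + 1) into -(2i + 2) and 2i; up to sign these are
  -- consecutive even numbers.
  moment-difference-M : ∀ i → moment-difference i ≡ M (- even (suc i)) + -1ℤ * M (even i)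
  moment-difference-M i = cong (λ x → moment (h ℕ.+ h) x + -1ℤ * M (even i)) (shift (+ i))
    where
    shift : ∀ i → - (1ℤ + (i + i)) ≡ 1ℤ + - ((1ℤ + i) + (1ℤ + i))
    shift = solve-∀

  -- The constants 1 in `G` cancel in the difference, and oddness replaces -G (2i) by G (-2i), so
  -- the sum telescopes. The ends give 1 + c, and the defect at i = 0 subtracts 2.
  alternating-sum : ∑[ i < h ] (-1ℤ ^ toℕ i * moment-difference (toℕ i)) ≈ c - 1ℤ
  alternating-sum = begin
    ∑[ i < h ] (-1ℤ ^ toℕ i * moment-difference (toℕ i))
      ≈⟨ telescope-≈ {f = λ i → -1ℤ ^ i * moment-difference i} g 0<h first step ⟩
    1ℤ * G 0ℤ - c * G (- even h) - + 2
      ≈⟨ +-congʳ (- (+ 2)) (+-cong (*-congˡ 1ℤ (+-congʳ 1ℤ M-0)) (neg-cong (*-congˡ c G-even-h))) ⟩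
    1ℤ * (0ℤ + 1ℤ) - c * -1ℤ - + 2
      ≡⟨ tidy c ⟩
    c - 1ℤ ∎
    where
    g : ℕ → ℤ
    g i = -1ℤ ^ i * G (- even i)
    tidy : ∀ c → 1ℤ * (0ℤ + 1ℤ) - c * -1ℤ - + 2 ≡ c - 1ℤ
    tidy = solve-∀
    split : ∀ e m m′ → e * (m′ + -1ℤ * m) ≡ e * - (m + 1ℤ) - -1ℤ * e * (m′ + 1ℤ)
    split = solve-∀
    -- At y = 0 oddness fails: G 0 ≡ 1, so -G 0 ≡ G 0 - 2, which is the defect -2.
    first : 1ℤ * moment-difference 0 ≈ g 0 - g 1 - + 2
    first = begin
      1ℤ * moment-difference 0
        ≡⟨ trans (cong (1ℤ *_) (moment-difference-M 0)) (split 1ℤ (M 0ℤ) (M (- even 1))) ⟩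
      1ℤ * - (M 0ℤ + 1ℤ) - g 1
        ≈⟨ +-congʳ (- g 1) (*-congˡ 1ℤ (neg-cong (+-congʳ 1ℤ M-0))) ⟩
      1ℤ * - (0ℤ + 1ℤ) - g 1
        ≡⟨ tidy-first (g 1) ⟩
      1ℤ * (0ℤ + 1ℤ) - g 1 - + 2
        ≈⟨ +-congʳ (- (+ 2)) (+-congʳ (- g 1) (*-congˡ 1ℤ (+-congʳ 1ℤ M-0))) ⟨
      g 0 - g 1 - + 2 ∎
      where
      tidy-first : ∀ z → 1ℤ * - (0ℤ + 1ℤ) - z ≡ 1ℤ * (0ℤ + 1ℤ) - z - + 2
      tidy-first = solve-∀
    step : ∀ {i} → 0 < i → i < h → -1ℤ ^ i * moment-difference i ≈ g i - g (suc i)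
    step {i} 0<i i<h = begin
      -1ℤ ^ i * moment-difference i
        ≡⟨ trans (cong (-1ℤ ^ i *_) (moment-difference-M i)) (split (-1ℤ ^ i) (M (even i)) (M (- even (suc i)))) ⟩
      -1ℤ ^ i * - G (even i) - g (suc i)
        ≈⟨ +-congʳ (- g (suc i)) (*-congˡ (-1ℤ ^ i) (G-odd (p∤even 0<i (ℕ.<⇒≤ i<h)))) ⟨
      g i - g (suc i) ∎

  -- The tangent numbers modulo p.

  weight : ℕ → ℤ
  weight i = c * -1ℤ ^ i

  -- The k-th derivative at 0 of 2 c Σ (-1)^i sin ((2i + 1) z), the candidate for tan modulo p.
  alternatingPowers : ℕ → ℤ
  alternatingPowers k = ∑[ i < h ] (+ 2 * weight (toℕ i) * (sin⁽ k ⁾ * odd (toℕ i) ^ k))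

  -- Times cos z, the i-th sine becomes c (-1)^i (sin ((2i + 2) z) + sin (2i z)). The sum telescopes
  -- to -c² sin (2h z), where c² = 1 and sin (2h z) reduces to sin (-z).
  alternatingPowers-timesCos : ∀ n → timesCos alternatingPowers n ≈ sin⁽ n ⁾
  alternatingPowers-timesCos n = begin
    timesCos alternatingPowers n
      ≡⟨ timesCos-∑ h (λ i → + 2 * weight i) (λ i k → sin⁽ k ⁾ * odd i ^ k) n ⟩
    ∑[ i < h ] (+ 2 * weight (toℕ i) * timesCos (λ k → sin⁽ k ⁾ * odd (toℕ i) ^ k) n)
      ≡⟨ sum-cong-≗ {h} (λ i → step (toℕ i)) ⟩
    ∑[ i < h ] (g (toℕ i) - g (suc (toℕ i)))
      ≡⟨ telescope h g ⟩
    1ℤ * (c * (s * 0ℤ ^ n)) - c * (c * (s * even h ^ n))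
      ≈⟨ +-congˡ (g 0) (neg-cong (*-congˡ c (*-congˡ c (*-congˡ s (^-cong n even-h≈-1))))) ⟩
    1ℤ * (c * (s * 0ℤ ^ n)) - c * (c * (s * -1ℤ ^ n))
      ≡⟨ cong₂ (λ y z → 1ℤ * (c * y) - c * (c * z)) (sin-0^ n) (sin-[-1]^ n) ⟩
    1ℤ * (c * 0ℤ) - c * (c * - s)
      ≡⟨ tidy c s ⟩
    c * c * s
      ≡⟨ cong (_* s) ([-1]^-square h) ⟩
    1ℤ * s
      ≡⟨ ℤ.*-identityˡ s ⟩
    s ∎
    where
    s = sin⁽ n ⁾
    g : ℕ → ℤ
    g i = -1ℤ ^ i * (c * (s * even i ^ n))
    tidy : ∀ c s → 1ℤ * (c * 0ℤ) - c * (c * - s) ≡ c * c * s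
    tidy = solve-∀
    pull : ∀ c e t → + 2 * (c * e) * t ≡ c * e * (+ 2 * t)
    pull = solve-∀
    split : ∀ c e s x y → c * e * (s * (x + y)) ≡ e * (c * (s * y)) - -1ℤ * e * (c * (s * x))
    split = solve-∀
    above : ∀ i → 1ℤ + (i + i) + 1ℤ ≡ (1ℤ + i) + (1ℤ + i)
    above = solve-∀
    below : ∀ i → 1ℤ + (i + i) + -1ℤ ≡ i + i
    below = solve-∀
    step : ∀ i → + 2 * weight i * timesCos (λ k → sin⁽ k ⁾ * odd i ^ k) n ≡ g i - g (suc i)
    step i =
      trans (pull c (-1ℤ ^ i) (timesCos (λ k → sin⁽ k ⁾ * odd i ^ k) n))
     (trans (cong (weight i *_) (sin-scaled-timesCos (odd i) n))
     (trans (cong₂ (λ x y → weight i * (s * (x ^ n + y ^ n))) (above (+ i)) (below (+ i)))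
            (split c (-1ℤ ^ i) s (even (suc i) ^ n) (even i ^ n))))

  -- Both sequences have the same product with cos modulo p.
  tangent-mod : ∀ {T} → IsTangentNumbers T → ∀ n → T n ≈ alternatingPowers n
  tangent-mod {T} isTan = timesCos-injective λ n →
    ≈-trans (≈-reflexive (tangent-timesCos {T} isTan n)) (≈-sym (alternatingPowers-timesCos n))

  -- The weighted tangent sum.

  tangent-sum : ∀ {T} → IsTangentNumbers T →
    sumOver (oddsUpTo (h ℕ.+ h)) (λ m → -1ℤ ^ ((m ℕ.+ 1) / 2) * + m * T m) ≈ 1ℤ - c
  tangent-sum {T} isTan = begin
    sumOver (oddsUpTo (h ℕ.+ h)) (λ m → -1ℤ ^ ((m ℕ.+ 1) / 2) * + m * T m)
      ≈⟨ sumOver-odds (h ℕ.+ h) term ⟩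
    ∑[ j < h ℕ.+ h ] ((1ℤ - -1ℤ ^ suc (toℕ j)) * e (suc (toℕ j)))
      ≡⟨ sum-cong-≗ {h ℕ.+ h} (λ j → *-distribˡ-sum {h} (1ℤ - -1ℤ ^ suc (toℕ j))
           (λ i → weight (toℕ i) * - (+ suc (toℕ j) * odd (toℕ i) ^ suc (toℕ j)))) ⟩
    ∑[ j < h ℕ.+ h ] ∑[ i < h ] q (toℕ i) (toℕ j)
      -- With i fixed, the sum over m is now a difference of two moments.
      ≡⟨ ∑-comm {h ℕ.+ h} {h} (λ j i → q (toℕ i) (toℕ j)) ⟩
    ∑[ i < h ] ∑[ j < h ℕ.+ h ] q (toℕ i) (toℕ j)
      ≡⟨ sum-cong-≗ {h} (λ i → inner (toℕ i)) ⟩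
    ∑[ i < h ] (c * (-1ℤ ^ toℕ i * moment-difference (toℕ i)))
      ≡⟨ *-distribˡ-sum {h} c (λ i → -1ℤ ^ toℕ i * moment-difference (toℕ i)) ⟨
    c * ∑[ i < h ] (-1ℤ ^ toℕ i * moment-difference (toℕ i))
      ≈⟨ *-congˡ c alternating-sum ⟩
    c * (c - 1ℤ)
      ≡⟨ distribute c ⟩
    c * c - c
      ≡⟨ cong (λ d → d - c) ([-1]^-square h) ⟩
    1ℤ - c ∎
    where
    e : ℕ → ℤ
    -- Half of the summand modulo p for odd m: the 2 is supplied by 1 - (-1)^m, and the minus sign
    -- comes from `sin-odd`.
    e m = ∑[ i < h ] (weight (toℕ i) * - (+ m * odd (toℕ i) ^ m))
    q : ℕ → ℕ → ℤ
    q i j = (1ℤ - -1ℤ ^ suc j) * (weight i * - (+ suc j * odd i ^ suc j))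
    distribute : ∀ c → c * (c - 1ℤ) ≡ c * c - c
    distribute = solve-∀

    term : ∀ m → ¬ 2 ℕ∣.∣ m → -1ℤ ^ ((m ℕ.+ 1) / 2) * + m * T m ≈ + 2 * e m
    term m 2∤m = begin
      σ * + m * T m
        ≈⟨ *-congˡ (σ * + m) (tangent-mod {T} isTan m) ⟩
      σ * + m * alternatingPowers m
        ≡⟨ *-distribˡ-sum {h} (σ * + m) (λ i → + 2 * weight (toℕ i) * (sin⁽ m ⁾ * odd (toℕ i) ^ m)) ⟩
      ∑[ i < h ] (σ * + m * (+ 2 * weight (toℕ i) * (sin⁽ m ⁾ * odd (toℕ i) ^ m)))
        ≡⟨ sum-cong-≗ {h} (λ i → trans
             (collect σ (+ m) (weight (toℕ i)) sin⁽ m ⁾ (odd (toℕ i) ^ m))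
             (trans (cong (λ t → + 2 * (weight (toℕ i) * (t * (+ m * odd (toℕ i) ^ m)))) (sin-odd m 2∤m))
                    (sign (weight (toℕ i)) (+ m * odd (toℕ i) ^ m)))) ⟩
      ∑[ i < h ] (+ 2 * (weight (toℕ i) * - (+ m * odd (toℕ i) ^ m)))
        ≡⟨ *-distribˡ-sum {h} (+ 2) (λ i → weight (toℕ i) * - (+ m * odd (toℕ i) ^ m)) ⟨
      + 2 * e m ∎
      where
      σ = -1ℤ ^ ((m ℕ.+ 1) / 2)
      collect : ∀ σ m w s x → σ * m * (+ 2 * w * (s * x)) ≡ + 2 * (w * (σ * s * (m * x)))
      collect = solve-∀
      sign : ∀ w t → + 2 * (w * (-1ℤ * t)) ≡ + 2 * (w * - t)
      sign = solve-∀

    -- (1 - (-1)^m) · (-m x^m) = m (-x)^m - m x^m, so summing over m gives the moments at -x and x.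
    inner : ∀ i → ∑[ j < h ℕ.+ h ] q i (toℕ j) ≡ c * (-1ℤ ^ i * moment-difference i)
    inner i =
      trans (sum-cong-≗ {h ℕ.+ h} (λ j → summand (toℕ j)))
     (trans (sym (*-distribˡ-sum {h ℕ.+ h} (weight i) (λ j → u (- odd i) (toℕ j) + -1ℤ * u (odd i) (toℕ j))))
     (trans (cong (weight i *_) (trans
              (∑-distrib-+ {h ℕ.+ h} (u (- odd i) ∘ toℕ) (λ j → -1ℤ * u (odd i) (toℕ j)))
              (cong (λ t → moment (h ℕ.+ h) (- odd i) + t)
                (sym (*-distribˡ-sum {h ℕ.+ h} -1ℤ (u (odd i) ∘ toℕ))))))
            (ℤ.*-assoc c (-1ℤ ^ i) (moment-difference i))))
      where
      u : ℤ → ℕ → ℤ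
      u x j = + suc j * x ^ suc j
      expand : ∀ ε w m x → (1ℤ - ε) * (w * - (m * x)) ≡ w * (m * (ε * x) + -1ℤ * (m * x))
      expand = solve-∀
      summand : ∀ j → q i j ≡ weight i * (u (- odd i) j + -1ℤ * u (odd i) j)
      summand j = trans (expand (-1ℤ ^ suc j) (weight i) (+ suc j) (odd i ^ suc j))
        (cong (λ t → weight i * (+ suc j * t + -1ℤ * u (odd i) j)) (sym (neg-^ (odd i) (suc j))))

-- The two residue classes modulo 4.

open import Data.Nat using (_+_)

theorem3 : (T : ℕ → ℤ) → IsTangentNumbers T →
    (p : ℕ) → Prime p → p > 3 →
    let S = sumOver (oddsUpTo (p ∸ 1)) (λ m → (-1ℤ ^ ((m + 1) / 2)) * (+ m) * T m)
    in (p % 4 ≡ 1 → S ≡ + 0 [mod p ]) × (p % 4 ≡ 3 → S ≡ + 2 [mod p ])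
theorem3 T isTan p p-prime _ = one , three
  where
  S : ℕ → ℤ
  S p = sumOver (oddsUpTo (p ∸ 1)) (λ m → (-1ℤ ^ ((m + 1) / 2)) * (+ m) * T m)

  -- Taking p with an equation lets `refl` substitute 2h + 1, after which `p ∸ 1` computes to
  -- `h + h`.
  S-mod : ∀ h {p} → Prime p → p ≡ suc (h + h) → S p ≡ 1ℤ ℤ.- -1ℤ ^ h [mod p ]
  S-mod h p-prime refl = ℤ∣.∣⇒∣ᵤ (Modulo._≈_.difference (OddPrime.tangent-sum h p-prime {T} isTan))

  q = p / 4

  [-1]^[q+q] : -1ℤ ^ (q + q) ≡ 1ℤ
  [-1]^[q+q] = trans (ℤ.^-distribˡ-+-* -1ℤ q q) ([-1]^-square q)

  -- Here p = 4q + 1, so h = 2q, c = 1 and 1 - c = 0.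
  one : p % 4 ≡ 1 → S p ≡ + 0 [mod p ]
  one p%4≡1 = subst (λ s → S p ≡ 1ℤ ℤ.- s [mod p ]) [-1]^[q+q] (S-mod (q + q) p-prime
    (trans (m≡m%n+[m/n]*n p 4) (trans (cong (_+ q ℕ.* 4) p%4≡1) (split q))))
    where
    split : ∀ q → 1 + q ℕ.* 4 ≡ suc ((q + q) + (q + q))
    split = ℕ-Solver.solve-∀

  -- Here p = 4q + 3, so h = 2q + 1, c = -1 and 1 - c = 2.
  three : p % 4 ≡ 3 → S p ≡ + 2 [mod p ]
  three p%4≡3 = subst (λ s → S p ≡ 1ℤ ℤ.- -1ℤ * s [mod p ]) [-1]^[q+q] (S-mod (suc (q + q)) p-prime
    (trans (m≡m%n+[m/n]*n p 4) (trans (cong (_+ q ℕ.* 4) p%4≡3) (split q))))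
    where
    split : ∀ q → 3 + q ℕ.* 4 ≡ suc (suc (q + q) + suc (q + q))
    split = ℕ-Solver.solve-∀
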